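{- Every two-solution ordinal algorithm for makespan minimization on $m=2$ identical machines has a competitive ratio of at least $1.25$.
   Context: Ordinal makespan scheduling on $m$ identical machines. Jobs are indexed by positive integers. A realization is a sequence of real job sizes $p_1\ge p_2\ge p_3\ge\cdots\ge 0$ with only finitely many positive sizes. A solution is a partition of the set of all positive integers into $m$ sets $J_1,\dots,J_m$ (some may be empty), where $J_i$ is the set of jobs assigned to machine $i$; it is fixed without knowledge of the realization. For a realization, the load of machine $i$ in the solution is $\sum_{j\in J_i}p_j$, and the completion time of the solution is the maximum load of any machine. A two-solution ordinal algorithm consists of two solutions; its makespan for a realization is the minimum of the completion times of its two solutions for that realization. The optimal offline completion time $\lambda$ of a realization is the minimum completion time over all solutions (chosen with full knowledge of the realization). The competitive ratio of the algorithm is the supremum, over all realizations with $\lambda>0$, of the ratio between its makespan and $\lambda$. -}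

module Defs where

open import Data.Fin.Base using (Fin)
import Data.Fin.Properties as Fin
open import Data.Integer.Base using (+_)
open import Data.List.Base using (List; foldr; map; filter; upTo)
open import Data.Nat.Base as ℕ using (ℕ; suc)
import Data.Nat.Properties as ℕ
open import Data.Product.Base using (Σ-syntax; ∃-syntax; _×_; _,_)
open import Data.Rational.Base as ℚ using (ℚ; 0ℚ; 1ℚ; ½; ∣_∣)
import Data.Rational.Properties as ℚ
open import Data.Rational.Solver using (module +-*-Solver)
open import Data.Sum.Base using (inj₁; inj₂)
open import Data.Vec.Base as Vec using (foldr₁)
open import Relation.Binary.PropositionalEquality

-- Real numbers as Cauchy sequences of rationals, compared with the setoid
-- equality _≃_.

Eventually : (ℕ → Set) → Set
Eventually P = ∃[ N ] ∀ n → N ℕ.≤ n → P n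

record ℝ : Set where
  constructor mkℝ
  field
    seq    : ℕ → ℚ
    cauchy : ∀ ε → 0ℚ ℚ.< ε →
             ∃[ N ] ∀ m n → N ℕ.≤ m → N ℕ.≤ n → ∣ seq m ℚ.- seq n ∣ ℚ.< ε

open ℝ public

infix 4 _≃_ _≤_ _<_

_≃_ : ℝ → ℝ → Set
x ≃ y = ∀ ε → 0ℚ ℚ.< ε → Eventually λ n → ∣ seq x n ℚ.- seq y n ∣ ℚ.< ε

_≤_ : ℝ → ℝ → Set
x ≤ y = ∀ ε → 0ℚ ℚ.< ε → Eventually λ n → seq x n ℚ.< seq y n ℚ.+ ε

_<_ : ℝ → ℝ → Set
x < y = ∃[ ε ] 0ℚ ℚ.< ε × Eventually λ n → seq x n ℚ.+ ε ℚ.< seq y n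

∣p-p∣≡0 : ∀ p → ∣ p ℚ.- p ∣ ≡ 0ℚ
∣p-p∣≡0 p = cong ∣_∣ (ℚ.+-inverseʳ p)

fromℚ : ℚ → ℝ
fromℚ p = mkℝ (λ _ → p) λ ε 0<ε →
  0 , λ _ _ _ _ → subst (ℚ._< ε) (sym (∣p-p∣≡0 p)) 0<ε

0ℝ : ℝ
0ℝ = fromℚ 0ℚ

0<½* : ∀ {ε} → 0ℚ ℚ.< ε → 0ℚ ℚ.< ½ ℚ.* ε
0<½* {ε} 0<ε = subst (ℚ._< ½ ℚ.* ε) (ℚ.*-zeroʳ ½) (ℚ.*-monoʳ-<-pos ½ 0<ε)

½*+½* : ∀ ε → ½ ℚ.* ε ℚ.+ ½ ℚ.* ε ≡ ε
½*+½* ε = trans (sym (ℚ.*-distribʳ-+ ε ½ ½)) (ℚ.*-identityˡ ε)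

p≤∣p∣ : ∀ p → p ℚ.≤ ∣ p ∣
p≤∣p∣ p with ℚ.≤-total 0ℚ p
... | inj₁ 0≤p = ℚ.≤-reflexive (sym (ℚ.0≤p⇒∣p∣≡p 0≤p))
... | inj₂ p≤0 = ℚ.≤-trans p≤0 (ℚ.0≤∣p∣ p)

∣p-q∣≡∣q-p∣ : ∀ p q → ∣ p ℚ.- q ∣ ≡ ∣ q ℚ.- p ∣
∣p-q∣≡∣q-p∣ p q = trans (cong ∣_∣ (lemma p q)) (ℚ.∣-p∣≡∣p∣ (q ℚ.- p))
  where
  open +-*-Solver
  lemma : ∀ p q → p ℚ.- q ≡ ℚ.- (q ℚ.- p)
  lemma = solve 2 (λ p q → p :- q := :- (q :- p)) refl

p≤q+∣p-q∣ : ∀ p q → p ℚ.≤ q ℚ.+ ∣ p ℚ.- q ∣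
p≤q+∣p-q∣ p q = subst (ℚ._≤ q ℚ.+ ∣ p ℚ.- q ∣) (lemma p q)
                      (ℚ.+-monoʳ-≤ q (p≤∣p∣ (p ℚ.- q)))
  where
  open +-*-Solver
  lemma : ∀ p q → q ℚ.+ (p ℚ.- q) ≡ p
  lemma = solve 2 (λ p q → q :+ (p :- q) := p) refl

∣p-q∣≤ : ∀ {p q s} → p ℚ.≤ q ℚ.+ s → q ℚ.≤ p ℚ.+ s → ∣ p ℚ.- q ∣ ℚ.≤ s
∣p-q∣≤ {p} {q} {s} p≤ q≤ with ℚ.∣p∣≡p∨∣p∣≡-p (p ℚ.- q)
... | inj₁ eq = subst₂ ℚ._≤_ (sym eq) (lemma q s) (ℚ.+-monoˡ-≤ (ℚ.- q) p≤)
  where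
  open +-*-Solver
  lemma : ∀ q s → q ℚ.+ s ℚ.- q ≡ s
  lemma = solve 2 (λ q s → q :+ s :- q := s) refl
... | inj₂ eq = subst₂ ℚ._≤_ (trans (lemma₁ p q) (sym eq)) (lemma₂ p s)
                             (ℚ.+-monoˡ-≤ (ℚ.- p) q≤)
  where
  open +-*-Solver
  lemma₁ : ∀ p q → q ℚ.- p ≡ ℚ.- (p ℚ.- q)
  lemma₁ = solve 2 (λ p q → q :- p := :- (p :- q)) refl
  lemma₂ : ∀ p s → p ℚ.+ s ℚ.- p ≡ s
  lemma₂ = solve 2 (λ p s → p :+ s :- p := s) refl

NonExpansive : (ℚ → ℚ → ℚ) → Set
NonExpansive _∙_ = ∀ a b c d →
  ∣ (a ∙ b) ℚ.- (c ∙ d) ∣ ℚ.≤ ∣ a ℚ.- c ∣ ℚ.+ ∣ b ℚ.- d ∣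

lift₂ : ∀ _∙_ → NonExpansive _∙_ → ℝ → ℝ → ℝ
lift₂ _∙_ nonExp x y = mkℝ (λ n → seq x n ∙ seq y n) λ ε 0<ε →
  let M , x-close = cauchy x (½ ℚ.* ε) (0<½* 0<ε)
      N , y-close = cauchy y (½ ℚ.* ε) (0<½* 0<ε)
  in M ℕ.⊔ N , λ m n m≥ n≥ →
     ℚ.≤-<-trans (nonExp (seq x m) (seq y m) (seq x n) (seq y n))
       (subst (∣ seq x m ℚ.- seq x n ∣ ℚ.+ ∣ seq y m ℚ.- seq y n ∣ ℚ.<_) (½*+½* ε)
         (ℚ.+-mono-< (x-close m n (ℕ.m⊔n≤o⇒m≤o M N m≥) (ℕ.m⊔n≤o⇒m≤o M N n≥))
                     (y-close m n (ℕ.m⊔n≤o⇒n≤o M N m≥) (ℕ.m⊔n≤o⇒n≤o M N n≥))))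

+-nonExpansive : NonExpansive ℚ._+_
+-nonExpansive a b c d =
  subst (ℚ._≤ ∣ a ℚ.- c ∣ ℚ.+ ∣ b ℚ.- d ∣) (cong ∣_∣ (lemma a b c d))
        (ℚ.∣p+q∣≤∣p∣+∣q∣ (a ℚ.- c) (b ℚ.- d))
  where
  open +-*-Solver
  lemma : ∀ a b c d → (a ℚ.- c) ℚ.+ (b ℚ.- d) ≡ (a ℚ.+ b) ℚ.- (c ℚ.+ d)
  lemma = solve 4 (λ a b c d → (a :- c) :+ (b :- d) := (a :+ b) :- (c :+ d)) refl

∣p∣≤∣p∣+∣q∣ : ∀ p q → ∣ p ∣ ℚ.≤ ∣ p ∣ ℚ.+ ∣ q ∣
∣p∣≤∣p∣+∣q∣ p q = subst (ℚ._≤ ∣ p ∣ ℚ.+ ∣ q ∣) (ℚ.+-identityʳ ∣ p ∣)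
                        (ℚ.+-monoʳ-≤ ∣ p ∣ (ℚ.0≤∣p∣ q))

∣q∣≤∣p∣+∣q∣ : ∀ p q → ∣ q ∣ ℚ.≤ ∣ p ∣ ℚ.+ ∣ q ∣
∣q∣≤∣p∣+∣q∣ p q = subst (∣ q ∣ ℚ.≤_) (ℚ.+-comm ∣ q ∣ ∣ p ∣) (∣p∣≤∣p∣+∣q∣ q p)

p≤q+∣p-q∣+r : ∀ p q r → p ℚ.≤ q ℚ.+ (∣ p ℚ.- q ∣ ℚ.+ ∣ r ∣)
p≤q+∣p-q∣+r p q r = ℚ.≤-trans (p≤q+∣p-q∣ p q)
  (ℚ.+-monoʳ-≤ q (∣p∣≤∣p∣+∣q∣ (p ℚ.- q) r))

p≤q+r+∣p-q∣ : ∀ p q r → p ℚ.≤ q ℚ.+ (∣ r ∣ ℚ.+ ∣ p ℚ.- q ∣)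
p≤q+r+∣p-q∣ p q r = ℚ.≤-trans (p≤q+∣p-q∣ p q)
  (ℚ.+-monoʳ-≤ q (∣q∣≤∣p∣+∣q∣ r (p ℚ.- q)))

⊔-nonExpansive : NonExpansive ℚ._⊔_
⊔-nonExpansive a b c d = ∣p-q∣≤ (half a b c d)
  (subst (λ s → c ℚ.⊔ d ℚ.≤ a ℚ.⊔ b ℚ.+ s)
         (cong₂ ℚ._+_ (∣p-q∣≡∣q-p∣ c a) (∣p-q∣≡∣q-p∣ d b)) (half c d a b))
  where
  half : ∀ a b c d → a ℚ.⊔ b ℚ.≤ c ℚ.⊔ d ℚ.+ (∣ a ℚ.- c ∣ ℚ.+ ∣ b ℚ.- d ∣)
  half a b c d = ℚ.⊔-lub
    (ℚ.≤-trans (p≤q+∣p-q∣+r a c (b ℚ.- d)) (ℚ.+-monoˡ-≤ _ (ℚ.p≤p⊔q c d)))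
    (ℚ.≤-trans (p≤q+r+∣p-q∣ b d (a ℚ.- c)) (ℚ.+-monoˡ-≤ _ (ℚ.p≤q⊔p c d)))

⊓-nonExpansive : NonExpansive ℚ._⊓_
⊓-nonExpansive a b c d = ∣p-q∣≤ (half a b c d)
  (subst (λ s → c ℚ.⊓ d ℚ.≤ a ℚ.⊓ b ℚ.+ s)
         (cong₂ ℚ._+_ (∣p-q∣≡∣q-p∣ c a) (∣p-q∣≡∣q-p∣ d b)) (half c d a b))
  where
  half : ∀ a b c d → a ℚ.⊓ b ℚ.≤ c ℚ.⊓ d ℚ.+ (∣ a ℚ.- c ∣ ℚ.+ ∣ b ℚ.- d ∣)
  half a b c d = subst (a ℚ.⊓ b ℚ.≤_)
    (sym (ℚ.mono-≤-distrib-⊓ (ℚ.+-monoˡ-≤ (∣ a ℚ.- c ∣ ℚ.+ ∣ b ℚ.- d ∣)) c d))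
    (ℚ.⊓-mono-≤ (p≤q+∣p-q∣+r a c (b ℚ.- d)) (p≤q+r+∣p-q∣ b d (a ℚ.- c)))

infixl 6 _+_ _⊔_
infixl 7 _*_ _⊓_

_+_ _⊔_ _⊓_ : ℝ → ℝ → ℝ
_+_ = lift₂ ℚ._+_ +-nonExpansive
_⊔_ = lift₂ ℚ._⊔_ ⊔-nonExpansive
_⊓_ = lift₂ ℚ._⊓_ ⊓-nonExpansive

0<1ℚ : 0ℚ ℚ.< 1ℚ
0<1ℚ = ℚ.positive⁻¹ 1ℚ

bounded : ∀ x → ∃[ B ] 0ℚ ℚ.< B × Eventually λ n → ∣ seq x n ∣ ℚ.≤ B
bounded x with cauchy x 1ℚ 0<1ℚ
... | N , close = ∣ x_N ∣ ℚ.+ 1ℚ , 0<B , N , bound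
  where
  x_N = seq x N
  open +-*-Solver
  lemma : ∀ p q → q ℚ.+ (p ℚ.- q) ≡ p
  lemma = solve 2 (λ p q → q :+ (p :- q) := p) refl
  0<B : 0ℚ ℚ.< ∣ x_N ∣ ℚ.+ 1ℚ
  0<B = ℚ.+-mono-≤-< (ℚ.0≤∣p∣ x_N) 0<1ℚ
  bound : ∀ n → N ℕ.≤ n → ∣ seq x n ∣ ℚ.≤ ∣ x_N ∣ ℚ.+ 1ℚ
  bound n N≤n = ℚ.≤-trans
    (subst (λ s → ∣ s ∣ ℚ.≤ ∣ x_N ∣ ℚ.+ ∣ seq x n ℚ.- x_N ∣) (lemma (seq x n) x_N)
           (ℚ.∣p+q∣≤∣p∣+∣q∣ x_N (seq x n ℚ.- x_N)))
    (ℚ.+-monoʳ-≤ ∣ x_N ∣ (ℚ.<⇒≤ (close n N N≤n ℕ.≤-refl)))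

∣ab-cd∣≤ : ∀ a b c d → ∣ a ℚ.* b ℚ.- c ℚ.* d ∣ ℚ.≤
           ∣ a ∣ ℚ.* ∣ b ℚ.- d ∣ ℚ.+ ∣ d ∣ ℚ.* ∣ a ℚ.- c ∣
∣ab-cd∣≤ a b c d = subst₂ ℚ._≤_ (cong ∣_∣ (sym (lemma a b c d)))
  (cong₂ ℚ._+_ (ℚ.∣p*q∣≡∣p∣*∣q∣ a (b ℚ.- d)) (ℚ.∣p*q∣≡∣p∣*∣q∣ d (a ℚ.- c)))
  (ℚ.∣p+q∣≤∣p∣+∣q∣ (a ℚ.* (b ℚ.- d)) (d ℚ.* (a ℚ.- c)))
  where
  open +-*-Solver
  lemma : ∀ a b c d → a ℚ.* b ℚ.- c ℚ.* d ≡ a ℚ.* (b ℚ.- d) ℚ.+ d ℚ.* (a ℚ.- c)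
  lemma = solve 4 (λ a b c d → a :* b :- c :* d := a :* (b :- d) :+ d :* (a :- c)) refl

scale : ∀ B ε → 0ℚ ℚ.< B → 0ℚ ℚ.< ε → ∃[ δ ] 0ℚ ℚ.< δ × B ℚ.* δ ≡ ε
scale B ε 0<B 0<ε = 1/B ℚ.* ε ,
  subst (ℚ._< 1/B ℚ.* ε) (ℚ.*-zeroʳ 1/B) (ℚ.*-monoʳ-<-pos 1/B 0<ε) ,
  trans (sym (ℚ.*-assoc B 1/B ε))
        (trans (cong (ℚ._* ε) (ℚ.*-inverseʳ B)) (ℚ.*-identityˡ ε))
  where
  instance
    B-pos : ℚ.Positive B
    B-pos = ℚ.positive 0<B
    B-nonZero : ℚ.NonZero B
    B-nonZero = ℚ.pos⇒nonZero B
  1/B = ℚ.1/ B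
  instance
    1/B-pos : ℚ.Positive 1/B
    1/B-pos = ℚ.1/pos⇒pos B

*-<-bound : ∀ {p q B δ} → 0ℚ ℚ.< B → ∣ p ∣ ℚ.≤ B → ∣ q ∣ ℚ.< δ →
            ∣ p ∣ ℚ.* ∣ q ∣ ℚ.< B ℚ.* δ
*-<-bound {p} {q} {B} 0<B p≤B q<δ = ℚ.≤-<-trans
  (ℚ.*-monoʳ-≤-nonNeg ∣ q ∣ {{ℚ.nonNegative (ℚ.0≤∣p∣ q)}} p≤B)
  (ℚ.*-monoʳ-<-pos B {{ℚ.positive 0<B}} q<δ)

*-cauchy : ∀ x y ε → 0ℚ ℚ.< ε → ∃[ N ] ∀ m n → N ℕ.≤ m → N ℕ.≤ n →
           ∣ seq x m ℚ.* seq y m ℚ.- seq x n ℚ.* seq y n ∣ ℚ.< ε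
*-cauchy x y ε 0<ε =
  let A , 0<A , K , x≤A = bounded x
      B , 0<B , L , y≤B = bounded y
      α , 0<α , Aα≡½ε   = scale A (½ ℚ.* ε) 0<A (0<½* 0<ε)
      β , 0<β , Bβ≡½ε   = scale B (½ ℚ.* ε) 0<B (0<½* 0<ε)
      M , y-close       = cauchy y α 0<α
      N , x-close       = cauchy x β 0<β
  in (K ℕ.⊔ L) ℕ.⊔ (M ℕ.⊔ N) , λ m n m≥ n≥ →
     let KL≤m = ℕ.m⊔n≤o⇒m≤o (K ℕ.⊔ L) (M ℕ.⊔ N) m≥
         MN≤m = ℕ.m⊔n≤o⇒n≤o (K ℕ.⊔ L) (M ℕ.⊔ N) m≥
         KL≤n = ℕ.m⊔n≤o⇒m≤o (K ℕ.⊔ L) (M ℕ.⊔ N) n≥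
         MN≤n = ℕ.m⊔n≤o⇒n≤o (K ℕ.⊔ L) (M ℕ.⊔ N) n≥
     in ℚ.≤-<-trans (∣ab-cd∣≤ (seq x m) (seq y m) (seq x n) (seq y n))
          (subst (_ ℚ.<_) (trans (cong₂ ℚ._+_ Aα≡½ε Bβ≡½ε) (½*+½* ε))
            (ℚ.+-mono-<
              (*-<-bound {seq x m} {seq y m ℚ.- seq y n} 0<A
                (x≤A m (ℕ.m⊔n≤o⇒m≤o K L KL≤m))
                (y-close m n (ℕ.m⊔n≤o⇒m≤o M N MN≤m) (ℕ.m⊔n≤o⇒m≤o M N MN≤n)))
              (*-<-bound {seq y n} {seq x m ℚ.- seq x n} 0<B
                (y≤B n (ℕ.m⊔n≤o⇒n≤o K L KL≤n))
                (x-close m n (ℕ.m⊔n≤o⇒n≤o M N MN≤m) (ℕ.m⊔n≤o⇒n≤o M N MN≤n)))))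

_*_ : ℝ → ℝ → ℝ
x * y = mkℝ (λ n → seq x n ℚ.* seq y n) (*-cauchy x y)

-- "c ≤ sup S". A supremum need not exist constructively as an element of ℝ, so
-- it is represented by the numbers lying strictly below it.
infix 4 _≤sup_
_≤sup_ : ℝ → (ℝ → Set) → Set
c ≤sup S = ∀ x → x < c → ∃[ s ] S s × x < s

sum : List ℝ → ℝ
sum = foldr _+_ 0ℝ

-- The natural number j stands for job j + 1.
record Realization : Set where
  field
    size          : ℕ → ℝ
    nonIncreasing : ∀ j → size (suc j) ≤ size j
    nonNegative   : ∀ j → 0ℝ ≤ size j
    -- All jobs of positive size are among the first jobCount ones.
    jobCount      : ℕ
    finite        : ∀ j → 0ℝ < size j → j ℕ.< jobCount

-- A partition into m labelled, possibly empty sets, given by mapping each job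
-- to the machine it is assigned to.
Solution : ℕ → Set
Solution m = ℕ → Fin m

-- Jobs from jobCount on have size zero, so they are left out of the sum.
load : ∀ {m} → Solution m → Realization → Fin m → ℝ
load σ p i = sum (map size (filter (λ j → σ j Fin.≟ i) (upTo jobCount)))
  where open Realization p

completionTime : ∀ {k} → Solution (suc k) → Realization → ℝ
completionTime σ p = foldr₁ _⊔_ (Vec.tabulate (load σ p))

-- The number of machines is suc k.
IsOptimum : ∀ k → Realization → ℝ → Set
IsOptimum k p opt =
  (∃[ σ ] completionTime {k} σ p ≃ opt) × (∀ σ → opt ≤ completionTime {k} σ p)

TwoSolutionAlgorithm : ℕ → Set
TwoSolutionAlgorithm m = Solution m × Solution m

makespan : ∀ {k} → TwoSolutionAlgorithm (suc k) → Realization → ℝ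
makespan (σ , τ) p = completionTime σ p ⊓ completionTime τ p

-- r is the quotient makespan / opt for some realization with opt > 0.
PerformanceRatio : ∀ {k} → TwoSolutionAlgorithm (suc k) → ℝ → Set
PerformanceRatio {k} A r =
  Σ[ p ∈ Realization ] ∃[ opt ]
    IsOptimum k p opt × 0ℝ < opt × r * opt ≃ makespan A p

CompetitiveRatioAtLeast : ∀ {k} → ℝ → TwoSolutionAlgorithm (suc k) → Set
CompetitiveRatioAtLeast c A = c ≤sup PerformanceRatio A

-- Consider the realizations
--   a = (2,2,2,1,1),  b = (3,2,2,1),  c = (2,1,1,1,1),  d = (4,1,1,1,1),
-- whose optima 4, 4, 3, 4 are half of the total size.  Loads are integers, so
-- a solution that does not split a realization evenly is off by a factor of
-- at least 5/4.  A solution that splits d evenly isolates the first job, hence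
-- splits none of a, b and c evenly; and no solution splits all of a, b and c
-- evenly.  So any two solutions both fail on one of the four realizations.
module Submission where

open import Defs
open import Data.Bool.Base using (true; false)
open import Data.Fin.Base using (Fin; zero; suc; toℕ)
open import Data.Fin.Patterns using (0F; 1F)
import Data.Fin.Properties as Fin
open import Data.Integer.Base using (+_)
open import Data.List.Base using ([]; _∷_; foldr; map; filter; upTo)
open import Data.List.Relation.Unary.All as ListAll using ([]; _∷_)
open import Data.Nat.Base as ℕ using (ℕ; zero; suc)
import Data.Nat.Properties as ℕ
open import Data.Product.Base as Product using (∃-syntax; _×_; _,_)
open import Data.Rational.Base as ℚ using (ℚ; 0ℚ; _/_; ∣_∣)
import Data.Rational.Properties as ℚ
open import Data.Sum.Base as Sum using (_⊎_; inj₁; inj₂)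
open import Data.Vec.Base as Vec using (Vec; []; _∷_)
open import Data.Vec.Relation.Unary.All as All using (All; []; _∷_)
open import Data.Vec.Relation.Unary.Linked as Linked using (Linked; []; [-]; _∷_)
open import Function.Base using (_∘_)
open import Relation.Binary.PropositionalEquality
open import Relation.Nullary.Decidable
  using (Dec; True; does; toWitness; map′; _×-dec_; _⊎-dec_)
open import Relation.Unary using (Decidable)

-- Rational constants inside the reals.

≡⇒≃ : ∀ x y → (∀ n → seq x n ≡ seq y n) → x ≃ y
≡⇒≃ x y eq ε 0<ε = 0 , λ n _ →
  subst (ℚ._< ε)
        (sym (trans (cong (λ q → ∣ q ℚ.- seq y n ∣) (eq n)) (∣p-p∣≡0 (seq y n))))
        0<ε

≤-pointwise : ∀ x y → (∀ n → seq x n ℚ.≤ seq y n) → x ≤ y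
≤-pointwise x y x≤y ε 0<ε = 0 , λ n _ →
  subst (ℚ._< seq y n ℚ.+ ε) (ℚ.+-identityʳ (seq x n)) (ℚ.+-mono-≤-< (x≤y n) 0<ε)

fromℚ-cancel-< : ∀ {p q} → fromℚ p < fromℚ q → p ℚ.< q
fromℚ-cancel-< {p} {q} (ε , 0<ε , N , p+ε<q) =
  ℚ.<-trans (subst (ℚ._< p ℚ.+ ε) (ℚ.+-identityʳ p) (ℚ.+-monoʳ-< p 0<ε))
            (p+ε<q N ℕ.≤-refl)

fromℚ-mono-< : ∀ {p q} → p ℚ.< q → fromℚ p < fromℚ q
-- `_<_` asks for a gap that leaves strict room below `q`, so `q - p` is too large; density supplies
-- a smaller one.
fromℚ-mono-< {p} {q} p<q = let r , p<r , r<q = ℚ.<-dense p<q in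
  r ℚ.- p , subst (ℚ._< r ℚ.- p) (ℚ.+-inverseʳ p) (ℚ.+-monoˡ-< (ℚ.- p) p<r) ,
  0 , λ _ _ → subst (ℚ._< q) (sym (p+[r-p]≡r p r)) r<q
  where
  open import Data.Rational.Solver using (module +-*-Solver)
  open +-*-Solver
  p+[r-p]≡r : ∀ p r → p ℚ.+ (r ℚ.- p) ≡ r
  p+[r-p]≡r = solve 2 (λ p r → p :+ (r :- p) := r) refl

<-fromℚ-≤-trans : ∀ {x p q} → x < fromℚ p → p ℚ.≤ q → x < fromℚ q
<-fromℚ-≤-trans (ε , 0<ε , N , x+ε<p) p≤q =
  ε , 0<ε , N , λ n N≤n → ℚ.<-≤-trans (x+ε<p n N≤n) p≤q

-- Lets evaluation settle claims about all 32 assignments of five jobs to two machines.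
allVec? : ∀ {m} n {P : Vec (Fin m) n → Set} → Decidable P → Dec (∀ v → P v)
allVec? zero    P? = map′ (λ { p [] → p }) (λ f → f []) (P? [])
allVec? (suc n) P? = map′ (λ { f (i ∷ v) → f i v }) (λ f i v → f (i ∷ v))
                          (Fin.all? λ i → allVec? n λ v → P? (i ∷ v))

-- Realizations with finitely many listed rational sizes.

lookupOr : ∀ {A : Set} {n} → A → Vec A n → ℕ → A
-- Sizes use the default 0, so jobs past the vector have size zero; assignments use machine `zero`.
lookupOr z []       _       = z
lookupOr z (x ∷ xs) zero    = x
lookupOr z (x ∷ xs) (suc j) = lookupOr z xs j

lookupOr-overflow : ∀ {A : Set} {n} z (xs : Vec A n) {j} → n ℕ.≤ j → lookupOr z xs j ≡ z
lookupOr-overflow z []       _           = refl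
lookupOr-overflow z (x ∷ xs) (ℕ.s≤s n≤j) = lookupOr-overflow z xs n≤j

lookupOr-nonNegative : ∀ {n} {ps : Vec ℚ n} → All (0ℚ ℚ.≤_) ps → ∀ j → 0ℚ ℚ.≤ lookupOr 0ℚ ps j
lookupOr-nonNegative []       j       = ℚ.≤-refl
lookupOr-nonNegative (p ∷ ps) zero    = p
lookupOr-nonNegative (p ∷ ps) (suc j) = lookupOr-nonNegative ps j

lookupOr-nonIncreasing : ∀ {n} {ps : Vec ℚ n} → All (0ℚ ℚ.≤_) ps → Linked ℚ._≥_ ps →
                         ∀ j → lookupOr 0ℚ ps (suc j) ℚ.≤ lookupOr 0ℚ ps j
lookupOr-nonIncreasing []       []       j       = ℚ.≤-refl
-- The last listed size is followed by the default 0, so the claim here is nonnegativity.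
lookupOr-nonIncreasing (p ∷ []) [-]      zero    = p
lookupOr-nonIncreasing (p ∷ []) [-]      (suc j) = ℚ.≤-refl
lookupOr-nonIncreasing {ps = _ ∷ _ ∷ _} (_ ∷ _)  (q ∷ _)  zero    = q
lookupOr-nonIncreasing {ps = _ ∷ _ ∷ _} (_ ∷ ps) (_ ∷ qs) (suc j) = lookupOr-nonIncreasing ps qs j

realization : ∀ {n} (ps : Vec ℚ n) → All (0ℚ ℚ.≤_) ps → Linked ℚ._≥_ ps → Realization
realization {n} ps nonNeg sorted = record
  { size          = size
  ; nonIncreasing = λ j → ≤-pointwise (size (suc j)) (size j) λ _ →
      lookupOr-nonIncreasing nonNeg sorted j
  ; nonNegative   = λ j → ≤-pointwise 0ℝ (size j) λ _ → lookupOr-nonNegative nonNeg j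
  ; jobCount      = n
  ; finite        = λ j 0<pⱼ → ℕ.≰⇒> λ n≤j →
      ℚ.<-irrefl (sym (lookupOr-overflow 0ℚ ps n≤j)) (fromℚ-cancel-< 0<pⱼ)
  }
  where
  size : ℕ → ℝ
  size j = fromℚ (lookupOr 0ℚ ps j)

-- Exact loads and completion times in ℚ.

sum-constant : ∀ (w : ℕ → ℚ) js n →
               seq (sum (map (fromℚ ∘ w) js)) n ≡ foldr ℚ._+_ 0ℚ (map w js)
sum-constant w []       n = refl
sum-constant w (j ∷ js) n = cong (w j ℚ.+_) (sum-constant w js n)

-- A rational counterpart of `load`: order on ℚ is decidable, order on `ℝ` is not.
loadℚ : ∀ {m n} → Solution m → Vec ℚ n → Fin m → ℚ
loadℚ {n = n} σ ps i =
  foldr ℚ._+_ 0ℚ (map (lookupOr 0ℚ ps) (filter (λ j → σ j Fin.≟ i) (upTo n)))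

completionTimeℚ : ∀ {n} → Solution 2 → Vec ℚ n → ℚ
completionTimeℚ σ ps = loadℚ σ ps zero ℚ.⊔ loadℚ σ ps (suc zero)

completionTime-constant : ∀ {n} σ (ps : Vec ℚ n) nonNeg sorted k →
  seq (completionTime {1} σ (realization ps nonNeg sorted)) k ≡ completionTimeℚ σ ps
completionTime-constant {n} σ ps _ _ k =
  cong₂ ℚ._⊔_ (load-constant zero) (load-constant (suc zero))
  where
  load-constant = λ i →
    sum-constant (lookupOr 0ℚ ps) (filter (λ j → σ j Fin.≟ i) (upTo n)) k

filter-agree : ∀ {m} {σ τ : Solution m} {js} → ListAll.All (λ j → σ j ≡ τ j) js → ∀ i →
               filter (λ j → σ j Fin.≟ i) js ≡ filter (λ j → τ j Fin.≟ i) js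
filter-agree []                            i = refl
filter-agree {σ = σ} {τ} {j ∷ js} (eq ∷ eqs) i
  rewrite eq with does (τ j Fin.≟ i)
... | true  = cong (j ∷_) (filter-agree eqs i)
... | false = filter-agree eqs i

completionTimeℚ-agree : ∀ {n} (σ τ : Solution 2) → ListAll.All (λ j → σ j ≡ τ j) (upTo n) →
                        (ps : Vec ℚ n) → completionTimeℚ σ ps ≡ completionTimeℚ τ ps
completionTimeℚ-agree σ τ eqs ps = cong₂ ℚ._⊔_ (load-agree zero) (load-agree (suc zero))
  where
  load-agree = λ i → cong (foldr ℚ._+_ 0ℚ ∘ map (lookupOr 0ℚ ps)) (filter-agree {σ = σ} {τ} eqs i)

-- One realization suffices: its ratio `M / opt` belongs to the set and is at least `c`, hence
-- exceeds every `x` below `c`.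
≤sup-intro : ∀ {k} {A : TwoSolutionAlgorithm (suc k)} {c opt M p} → 0ℚ ℚ.< opt →
             IsOptimum k p (fromℚ opt) → (∀ n → seq (makespan A p) n ≡ M) →
             c ℚ.* opt ℚ.≤ M → CompetitiveRatioAtLeast (fromℚ c) A
≤sup-intro {A = A} {c} {opt} {M} {p} 0<opt isOpt makespan≡M c*opt≤M x x<c =
  fromℚ r ,
  (p , fromℚ opt , isOpt , fromℚ-mono-< 0<opt ,
   ≡⇒≃ (fromℚ r * fromℚ opt) (makespan A p) λ n → trans r*opt≡M (sym (makespan≡M n))) ,
  <-fromℚ-≤-trans {x} x<c
    (ℚ.*-cancelʳ-≤-pos opt (subst (c ℚ.* opt ℚ.≤_) (sym r*opt≡M) c*opt≤M))
  where
  instance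
    opt-pos : ℚ.Positive opt
    opt-pos = ℚ.positive 0<opt
    opt-nonZero : ℚ.NonZero opt
    opt-nonZero = ℚ.pos⇒nonZero opt
  r = M ℚ.* ℚ.1/ opt
  r*opt≡M : r ℚ.* opt ≡ M
  r*opt≡M = trans (ℚ.*-assoc M (ℚ.1/ opt) opt)
                  (trans (cong (M ℚ.*_) (ℚ.*-inverseˡ opt)) (ℚ.*-identityʳ M))

-- Five-job instances verified by evaluation.

⟦_⟧ : Vec (Fin 2) 5 → Solution 2
⟦ v ⟧ = lookupOr zero v

prefix : Solution 2 → Vec (Fin 2) 5
prefix σ = Vec.tabulate (σ ∘ toℕ)

-- Only jobs 0 to 4 are summed, and on each of them both solutions agree by computation. Infinite
-- solutions thus reduce to 32 vectors.
completionTimeℚ-prefix : ∀ σ ps → completionTimeℚ ⟦ prefix σ ⟧ ps ≡ completionTimeℚ σ ps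
completionTimeℚ-prefix σ =
  completionTimeℚ-agree ⟦ prefix σ ⟧ σ (refl ∷ refl ∷ refl ∷ refl ∷ refl ∷ [])

record Instance : Set where
  constructor mkInstance
  field
    sizes       : Vec ℚ 5
    nonNeg      : All (0ℚ ℚ.≤_) sizes
    sorted      : Linked ℚ._≥_ sizes
    opt         : ℚ
    0<opt       : 0ℚ ℚ.< opt
    optSolution : Vec (Fin 2) 5
    attained    : completionTimeℚ ⟦ optSolution ⟧ sizes ≡ opt
    minimal     : ∀ v → opt ℚ.≤ completionTimeℚ ⟦ v ⟧ sizes

open Instance

-- Every field of `Instance` is decidable, so the type checker fills the `True` argument by
-- evaluation; minimality is an exhaustive search.
ℕ-instance : (ws : Vec ℕ 5) (o : ℕ) (v : Vec (Fin 2) 5) →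
  let ps = Vec.map (λ w → + w / 1) ws
      isInstance? = All.all? (0ℚ ℚ.≤?_) ps ×-dec
                    Linked.linked? (λ p q → q ℚ.≤? p) ps ×-dec
                    0ℚ ℚ.<? + o / 1 ×-dec
                    completionTimeℚ ⟦ v ⟧ ps ℚ.≟ + o / 1 ×-dec
                    allVec? 5 λ u → + o / 1 ℚ.≤? completionTimeℚ ⟦ u ⟧ ps
  in {True isInstance?} → Instance
ℕ-instance ws o v {t} =
  let nonNeg , sorted , 0<o , attained , minimal = toWitness t
  in mkInstance _ nonNeg sorted _ 0<o v attained minimal

-- Equality is included: for optimum 4 the next integer load 5 meets the bound exactly, while for
-- optimum 3 the load 4 is above 15/4.
Exceeds : Instance → Solution 2 → Set
Exceeds I σ = + 5 / 4 ℚ.* opt I ℚ.≤ completionTimeℚ σ (sizes I)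

exceeds? : ∀ I → Decidable (Exceeds I)
exceeds? I σ = + 5 / 4 ℚ.* opt I ℚ.≤? completionTimeℚ σ (sizes I)

bothExceed⇒≥5/4 : ∀ I {σ τ} → Exceeds I σ → Exceeds I τ →
                  CompetitiveRatioAtLeast (fromℚ (+ 5 / 4)) (σ , τ)
bothExceed⇒≥5/4 I {σ} {τ} σ-exceeds τ-exceeds =
  ≤sup-intro {p = p} (0<opt I) ((⟦ optSolution I ⟧ , isAttained) , isMinimal)
    (λ n → cong₂ ℚ._⊓_ (constant σ n) (constant τ n))
    (ℚ.⊓-glb σ-exceeds τ-exceeds)
  where
  p = realization (sizes I) (nonNeg I) (sorted I)
  constant : ∀ ρ n → seq (completionTime {1} ρ p) n ≡ completionTimeℚ ρ (sizes I)
  constant ρ = completionTime-constant ρ (sizes I) (nonNeg I) (sorted I)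
  isAttained : completionTime {1} ⟦ optSolution I ⟧ p ≃ fromℚ (opt I)
  isAttained = ≡⇒≃ (completionTime {1} ⟦ optSolution I ⟧ p) (fromℚ (opt I)) λ n →
    trans (constant ⟦ optSolution I ⟧ n) (attained I)
  isMinimal : ∀ ρ → fromℚ (opt I) ≤ completionTime {1} ρ p
  isMinimal ρ = ≤-pointwise (fromℚ (opt I)) (completionTime {1} ρ p) λ n →
    -- `minimal` covers five-job assignments only, so `ρ` is traded for its prefix.
    subst (opt I ℚ.≤_)
          (trans (completionTimeℚ-prefix ρ (sizes I)) (sym (constant ρ n)))
          (minimal I (prefix ρ))

a b c d : Instance
a = ℕ-instance (2 ∷ 2 ∷ 2 ∷ 1 ∷ 1 ∷ []) 4 (0F ∷ 0F ∷ 1F ∷ 1F ∷ 1F ∷ [])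
-- The fifth job of size 0 is padding to the common length.
b = ℕ-instance (3 ∷ 2 ∷ 2 ∷ 1 ∷ 0 ∷ []) 4 (0F ∷ 1F ∷ 1F ∷ 0F ∷ 0F ∷ [])
c = ℕ-instance (2 ∷ 1 ∷ 1 ∷ 1 ∷ 1 ∷ []) 3 (0F ∷ 0F ∷ 1F ∷ 1F ∷ 1F ∷ [])
d = ℕ-instance (4 ∷ 1 ∷ 1 ∷ 1 ∷ 1 ∷ []) 4 (0F ∷ 1F ∷ 1F ∷ 1F ∷ 1F ∷ [])

Exceeds-prefix : ∀ I σ → Exceeds I ⟦ prefix σ ⟧ → Exceeds I σ
Exceeds-prefix I σ = subst (+ 5 / 4 ℚ.* opt I ℚ.≤_) (completionTimeℚ-prefix σ (sizes I))

-- With the first job alone, the other machine gets 6, 5 and 4 in `a`, `b` and `c`, against optima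
-- 4, 4 and 3.
exceeds-d⊎abc : ∀ σ → Exceeds d σ ⊎ Exceeds a σ × Exceeds b σ × Exceeds c σ
exceeds-d⊎abc σ =
  Sum.map (lift d) (Product.map (lift a) (Product.map (lift b) (lift c))) (check (prefix σ))
  where
  lift = λ I → Exceeds-prefix I σ
  check : ∀ v → let ρ = ⟦ v ⟧ in
          Exceeds d ρ ⊎ Exceeds a ρ × Exceeds b ρ × Exceeds c ρ
  check = toWitness {a? = allVec? 5 λ v → let ρ = ⟦ v ⟧ in
          exceeds? d ρ ⊎-dec exceeds? a ρ ×-dec exceeds? b ρ ×-dec exceeds? c ρ} _

-- An even split of `c` gives the first job exactly one companion. Evenness of `a` then makes it the
-- second or third job, but in `b` either of these already brings the load to 5.
exceeds-a⊎b⊎c : ∀ σ → Exceeds a σ ⊎ Exceeds b σ ⊎ Exceeds c σ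
exceeds-a⊎b⊎c σ =
  Sum.map (lift a) (Sum.map (lift b) (lift c)) (check (prefix σ))
  where
  lift = λ I → Exceeds-prefix I σ
  check : ∀ v → let ρ = ⟦ v ⟧ in
          Exceeds a ρ ⊎ Exceeds b ρ ⊎ Exceeds c ρ
  check = toWitness {a? = allVec? 5 λ v → let ρ = ⟦ v ⟧ in
          exceeds? a ρ ⊎-dec exceeds? b ρ ⊎-dec exceeds? c ρ} _

commonExcess : ∀ σ τ → ∃[ I ] Exceeds I σ × Exceeds I τ
commonExcess σ τ = combine (exceeds-d⊎abc σ) (exceeds-d⊎abc τ)
  where
  one-of-abc : ∀ {ρ π} → Exceeds a ρ × Exceeds b ρ × Exceeds c ρ →
               Exceeds a π ⊎ Exceeds b π ⊎ Exceeds c π → ∃[ I ] Exceeds I ρ × Exceeds I π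
  one-of-abc (ρ-a , _ , _) (inj₁ π-a)        = a , ρ-a , π-a
  one-of-abc (_ , ρ-b , _) (inj₂ (inj₁ π-b)) = b , ρ-b , π-b
  one-of-abc (_ , _ , ρ-c) (inj₂ (inj₂ π-c)) = c , ρ-c , π-c
  combine : Exceeds d σ ⊎ Exceeds a σ × Exceeds b σ × Exceeds c σ →
            Exceeds d τ ⊎ Exceeds a τ × Exceeds b τ × Exceeds c τ →
            ∃[ I ] Exceeds I σ × Exceeds I τ
  combine (inj₁ σ-d)   (inj₁ τ-d)   = d , σ-d , τ-d
  -- One solution fails on all of `a`, `b`, `c`, so whichever of them the other fails on is common.
  combine (inj₂ σ-abc) _            = one-of-abc {σ} {τ} σ-abc (exceeds-a⊎b⊎c τ)
  combine (inj₁ _)     (inj₂ τ-abc) =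
    Product.map₂ Product.swap (one-of-abc {τ} {σ} τ-abc (exceeds-a⊎b⊎c σ))

proposition7 : (A : TwoSolutionAlgorithm 2) → CompetitiveRatioAtLeast (fromℚ (+ 5 / 4)) A
proposition7 (σ , τ) = let I , σ-exceeds , τ-exceeds = commonExcess σ τ in
  bothExceed⇒≥5/4 I σ-exceeds τ-exceeds
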